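{- The minimum order of a connected graph whose metric subgraphs are all cycles is $15$. Moreover, up to isomorphism there are exactly three connected graphs of order $15$ whose metric subgraphs are all cycles, and each of them has size (number of edges) $35$.
   Context: All graphs are finite and simple. For a connected graph $G$ and vertices $u,v$, $d(u,v)$ is the distance between them; the eccentricity of $v$ is $e(v)=\max\{d(v,u): u\in V(G)\}$; $\mathrm{rad}(G)$ and $\mathrm{diam}(G)$ are the minimum and maximum eccentricities. The center $C(G)$ is the set of vertices $v$ with $e(v)=\mathrm{rad}(G)$; the periphery $P(G)$ is the set of vertices with $e(v)=\mathrm{diam}(G)$; the annulus $A(G)$ is the set of vertices $w$ with $\mathrm{rad}(G)<e(w)<\mathrm{diam}(G)$. The subgraphs of $G$ induced by $C(G)$, $A(G)$, $P(G)$ are the central, annular and peripheral subgraphs, collectively the metric subgraphs of $G$. The order of a graph is its number of vertices; a cycle has at least three vertices. -}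

module Defs where

open import Data.Nat using (ℕ; zero; suc; _+_; _≤_; _<_; _%_)
open import Data.Nat.Base using (_<ᵇ_)
open import Data.Bool using (Bool; true; false; if_then_else_; _∧_)
open import Data.Fin using (Fin; toℕ)
open import Data.List using (List; map; allFin)
open import Data.Nat.ListAction using (sum)
open import Data.Product using (Σ; ∃; _×_; _,_)
open import Data.Sum using (_⊎_)
open import Relation.Nullary using (¬_)
open import Relation.Binary.PropositionalEquality using (_≡_)
open import Function.Bundles using (_↔_; Inverse)
open import Function.Definitions using (Injective)

record Graph (n : ℕ) : Set where
  field
    adj    : Fin n → Fin n → Bool
    sym    : ∀ i j → adj i j ≡ adj j i
    irrefl : ∀ i → adj i i ≡ false

open Graph public

module _ {n : ℕ} (G : Graph n) where

  Adj : Fin n → Fin n → Set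
  Adj u v = adj G u v ≡ true

  data Walk : Fin n → Fin n → ℕ → Set where
    here : ∀ {u} → Walk u u 0
    step : ∀ {u w v k} → Adj u w → Walk w v k → Walk u v (suc k)

  Connected : Set
  Connected = ∀ u v → ∃ λ k → Walk u v k

  Dist : Fin n → Fin n → ℕ → Set
  Dist u v k = Walk u v k × (∀ j → Walk u v j → k ≤ j)

  Ecc : Fin n → ℕ → Set
  Ecc v e = (∀ u k → Dist v u k → k ≤ e) × (∃ λ u → Dist v u e)

  Rad : ℕ → Set
  Rad r = (∃ λ v → Ecc v r) × (∀ v e → Ecc v e → r ≤ e)

  Diam : ℕ → Set
  Diam d = (∃ λ v → Ecc v d) × (∀ v e → Ecc v e → e ≤ d)

  Center : Fin n → Set
  Center v = ∃ λ r → Rad r × Ecc v r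

  Periphery : Fin n → Set
  Periphery v = ∃ λ d → Diam d × Ecc v d

  Annulus : Fin n → Set
  Annulus w = Σ ℕ λ r → Σ ℕ λ d → Σ ℕ λ e →
    Rad r × Diam d × Ecc w e × r < e × e < d

  InducedCycle : (Fin n → Set) → Set
  InducedCycle S = Σ ℕ λ k → let m = suc (suc (suc k)) in
    Σ (Fin m → Fin n) λ c →
      Injective _≡_ _≡_ c
      × (∀ x → S x → ∃ λ i → c i ≡ x)
      × (∀ i → S (c i))
      × (∀ i j → Adj (c i) (c j) →
            (toℕ j ≡ suc (toℕ i) % m) ⊎ (toℕ i ≡ suc (toℕ j) % m))
      × (∀ i j → (toℕ j ≡ suc (toℕ i) % m) ⊎ (toℕ i ≡ suc (toℕ j) % m) →
            Adj (c i) (c j))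

  MetricCycles : Set
  MetricCycles = InducedCycle Center × InducedCycle Annulus × InducedCycle Periphery

  size : ℕ
  size = sum (map (λ i → sum (map (λ j →
           if (toℕ i <ᵇ toℕ j) ∧ adj G i j then 1 else 0) (allFin n))) (allFin n))

Iso : ∀ {n} → Graph n → Graph n → Set
Iso {n} G H = Σ (Fin n ↔ Fin n) λ φ →
  ∀ i j → adj H (Inverse.to φ i) (Inverse.to φ j) ≡ adj G i j

{-# OPTIONS --safe #-}
-- A peripheral vertex and a vertex farthest from it both lie on the peripheral cycle, so this
-- cycle has order at least 2 diam.  As the annulus is nonempty, rad + 2 ≤ diam ≤ 2 rad.
-- With order ≤ 15 this forces rad = 2 and diam = 4, and every peripheral vertex then reaches every
-- central one through an annular neighbour.  Neighbours of two peripheral vertices at distance 4 are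
-- distinct and nonadjacent, so the annulus has order at least 4 and 3 + 4 + 8 = 15 is minimal.
-- At order 15 each peripheral u has a single annular neighbour f u ∈ ℤ/4, with f (u + 4) = f u + 2
-- and f (u + 1) ≠ f u + 2.  Hence f moves by steps 0, ±1 and is surjective, so the center is
-- completely joined to the annulus and the graph is determined by f.  Up to the dihedral symmetries
-- of the two cycles there are three such f, with step patterns (1,1,0,0), (1,0,1,0), (1,1,1,-1).
module Submission where

open import Defs renaming (sym to adj-sym)
open import Data.Bool using (Bool; true; false; if_then_else_; _∧_)
open import Data.Bool.Properties using (¬-not) renaming (_≟_ to _≟ᵇ_)
open import Data.Fin using (Fin; zero; suc; toℕ; fromℕ<; #_)
open import Data.Fin.Properties
  using (all?; any?; +↔⊎; toℕ<n; toℕ-fromℕ<; toℕ-injective; injective⇒≤) renaming (_≟_ to _≟ᶠ_)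
open import Data.List using (map; allFin; tabulate)
open import Data.List.Membership.Propositional.Properties using (∈-allFin)
open import Data.List.Properties using (map-tabulate)
open import Data.List.Relation.Unary.All using () renaming (lookup to lookupAll)
open import Data.Nat
open import Data.Nat.DivMod
  using (m%n<n; m<n⇒m%n≡m; %-distribˡ-+; m%n%n≡m%n; [m+n]%n≡m%n)
open import Data.Nat.ListAction using (sum)
open import Data.Nat.Properties
open import Data.Nat.Tactic.RingSolver using (solve-∀)
open import Data.Product using (Σ; ∃; _×_; _,_; proj₁; proj₂)
open import Data.Sum using (_⊎_; inj₁; inj₂; [_,_]; swap)
open import Data.Sum.Function.Propositional using (_⊎-↔_)
open import Data.Vec using (_∷_; []; lookup)
open import Function using (_∘_; id)
open import Function.Bundles using (_↔_; Inverse; Injection; mk↔ₛ′)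
open import Function.Construct.Composition using (_↔-∘_)
open import Function.Construct.Identity using (↔-id)
open import Function.Construct.Symmetry using (↔-sym)
open import Function.Definitions using (Injective)
open import Function.Properties.Inverse using (↔⇒↣)
open import Relation.Binary.Definitions using (tri<; tri≈; tri>)
open import Relation.Binary.PropositionalEquality
  using (_≡_; _≢_; refl; sym; trans; cong; cong₂; subst; subst₂; module ≡-Reasoning)
open import Relation.Nullary using (¬_; Dec; yes; no; does; contradiction)
open import Relation.Nullary.Decidable
  using (from-yes; from-no; _×-dec_; _⊎-dec_; _→-dec_; ¬?; dec-true; dec-false)

open import Algebra.Properties.CommutativeMonoid.Sum +-0-commutativeMonoid
  using (sum-cong-≗; ∑-distrib-+; ∑-comm; ∑-permute) renaming (sum to ∑)
open import Data.List.Extrema ≤-totalOrder using (argmax; f[xs]≤f[argmax])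

open Inverse using (to; from; strictlyInverseˡ; strictlyInverseʳ)

-- Adjacency on cycles.

CycAdj : ∀ {k} → Fin (3 + k) → Fin (3 + k) → Set
CycAdj {k} i j = (toℕ j ≡ suc (toℕ i) % (3 + k)) ⊎ (toℕ i ≡ suc (toℕ j) % (3 + k))

cycAdj? : ∀ {k} (i j : Fin (3 + k)) → Dec (CycAdj i j)
cycAdj? {k} i j = (toℕ j ≟ suc (toℕ i) % (3 + k)) ⊎-dec (toℕ i ≟ suc (toℕ j) % (3 + k))

cyc : ∀ {k} → Fin (3 + k) → Fin (3 + k) → Bool
cyc i j = does (cycAdj? i j)

-- Lets two Boolean adjacencies be identified by proving the propositions they decide equivalent.
≡true-ext : ∀ {a b} → (a ≡ true → b ≡ true) → (b ≡ true → a ≡ true) → a ≡ b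
≡true-ext {true}  {true}  _ _ = refl
≡true-ext {false} {false} _ _ = refl
≡true-ext {true}  {false} f _ = sym (f refl)
≡true-ext {false} {true}  _ g = g refl

does⇒ : ∀ {P : Set} (P? : Dec P) → does P? ≡ true → P
does⇒ (yes p) _ = p

cyc-sym : ∀ {k} (i j : Fin (3 + k)) → cyc i j ≡ cyc j i
cyc-sym i j = ≡true-ext
  (λ e → dec-true (cycAdj? j i) (swap (does⇒ (cycAdj? i j) e)))
  (λ e → dec-true (cycAdj? i j) (swap (does⇒ (cycAdj? j i) e)))

next : ∀ {k} → Fin (3 + k) → Fin (3 + k)
next {k} i = fromℕ< (m%n<n (suc (toℕ i)) (3 + k))

shift : ∀ {k} → ℕ → Fin (3 + k) → Fin (3 + k)
shift zero    i = i
shift (suc s) i = next (shift s i)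

neg : ∀ {k} → Fin (3 + k) → Fin (3 + k)
neg {k} i = fromℕ< (m%n<n ((3 + k) ∸ toℕ i) (3 + k))

opp : Fin 4 → Fin 4
opp = shift 2

antipode : Fin 8 → Fin 8
antipode = shift 4

-- The candidate graphs of order 15.

V : Set
V = Fin 3 ⊎ Fin 4 ⊎ Fin 8

pattern C i = inj₁ i
pattern A i = inj₂ (inj₁ i)
pattern P i = inj₂ (inj₂ i)

code : Fin 15 ↔ V
code = (↔-id (Fin 3) ⊎-↔ +↔⊎ {4} {8}) ↔-∘ +↔⊎ {3} {12}

-- f u is the only annular neighbour of the peripheral vertex u.
adjV : (Fin 8 → Fin 4) → V → V → Bool
adjV f (C i) (C j) = cyc i j
adjV f (C i) (A a) = true
adjV f (C i) (P u) = false
adjV f (A a) (C i) = true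
adjV f (A a) (A b) = cyc a b
adjV f (A a) (P u) = does (f u ≟ᶠ a)
adjV f (P u) (C i) = false
adjV f (P u) (A a) = does (f u ≟ᶠ a)
adjV f (P u) (P v) = cyc u v

adjV-sym : ∀ f x y → adjV f x y ≡ adjV f y x
adjV-sym f (C i) (C j) = cyc-sym i j
adjV-sym f (C i) (A a) = refl
adjV-sym f (C i) (P u) = refl
adjV-sym f (A a) (C i) = refl
adjV-sym f (A a) (A b) = cyc-sym a b
adjV-sym f (A a) (P u) = refl
adjV-sym f (P u) (C i) = refl
adjV-sym f (P u) (A a) = refl
adjV-sym f (P u) (P v) = cyc-sym u v

adjV-irrefl : ∀ f x → adjV f x x ≡ false
adjV-irrefl f (C i) = from-yes (all? {3} λ i → cyc i i ≟ᵇ false) i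
adjV-irrefl f (A a) = from-yes (all? {4} λ a → cyc a a ≟ᵇ false) a
adjV-irrefl f (P u) = from-yes (all? {8} λ u → cyc u u ≟ᵇ false) u

H : (Fin 8 → Fin 4) → Graph 15
H f = record
  { adj    = λ i j → adjV f (to code i) (to code j)
  ; sym    = λ i j → adjV-sym f (to code i) (to code j)
  ; irrefl = λ i → adjV-irrefl f (to code i)
  }

-- Builds in the relation `f (u + 4) = f u + 2`: the values on half of the peripheral cycle fix the
-- other half, which leaves 256 candidates for a finite search.
spread : Fin 4 → Fin 4 → Fin 4 → Fin 4 → Fin 8 → Fin 4
spread a b c d = lookup (a ∷ b ∷ c ∷ d ∷ opp a ∷ opp b ∷ opp c ∷ opp d ∷ [])

-- The step patterns (1,1,0,0), (1,0,1,0) and (1,1,1,-1).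
attachment : Fin 3 → Fin 8 → Fin 4
attachment zero             = spread (# 0) (# 1) (# 2) (# 2)
attachment (suc zero)       = spread (# 0) (# 1) (# 1) (# 2)
attachment (suc (suc zero)) = spread (# 0) (# 1) (# 2) (# 3)

-- Cycle automorphisms and the classification of attachments.

record CycAut (k : ℕ) : Set where
  field
    bij  : Fin (3 + k) ↔ Fin (3 + k)
    pres : ∀ i j → cyc (to bij i) (to bij j) ≡ cyc i j
open CycAut

idAut : ∀ {k} → CycAut k
idAut = record { bij = ↔-id _ ; pres = λ _ _ → refl }

_∘Aut_ : ∀ {k} → CycAut k → CycAut k → CycAut k
α ∘Aut β = record
  { bij  = bij α ↔-∘ bij β
  ; pres = λ i j → trans (pres α (to (bij β) i) (to (bij β) j)) (pres β i j)
  }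

_^Aut_ : ∀ {k} → CycAut k → ℕ → CycAut k
α ^Aut zero  = idAut
α ^Aut suc s = α ∘Aut (α ^Aut s)

-- shift (2 + k) inverts next on Fin (3 + k).
rot₄ neg₄ : CycAut 1
rot₄ = record
  { bij  = mk↔ₛ′ next (shift 3)
             (from-yes (all? λ (i : Fin 4) → next (shift 3 i) ≟ᶠ i))
             (from-yes (all? λ (i : Fin 4) → shift 3 (next i) ≟ᶠ i))
  ; pres = from-yes (all? λ (i : Fin 4) → all? λ (j : Fin 4) → cyc (next i) (next j) ≟ᵇ cyc i j)
  }
neg₄ = record
  { bij  = mk↔ₛ′ neg neg neg-neg neg-neg
  ; pres = from-yes (all? λ (i : Fin 4) → all? λ (j : Fin 4) → cyc (neg i) (neg j) ≟ᵇ cyc i j)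
  }
  where
  neg-neg : (i : Fin 4) → neg (neg i) ≡ i
  neg-neg = from-yes (all? λ (i : Fin 4) → neg (neg i) ≟ᶠ i)

rot₈ : CycAut 5
rot₈ = record
  { bij  = mk↔ₛ′ next (shift 7)
             (from-yes (all? λ (i : Fin 8) → next (shift 7 i) ≟ᶠ i))
             (from-yes (all? λ (i : Fin 8) → shift 7 (next i) ≟ᶠ i))
  ; pres = from-yes (all? λ (i : Fin 8) → all? λ (j : Fin 8) → cyc (next i) (next j) ≟ᵇ cyc i j)
  }

-- All eight symmetries of the 4-cycle: a rotation after an optional reflection.
dihedral₄ : Fin 2 → Fin 4 → CycAut 1
dihedral₄ zero    s = rot₄ ^Aut toℕ s
dihedral₄ (suc _) s = (rot₄ ^Aut toℕ s) ∘Aut neg₄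

-- The two motions, together with the identity on the center, form an isomorphism from `H f` to
-- `H g`.
Intertwined : (f g : Fin 8 → Fin 4) → Fin 4 → Fin 2 → Fin 4 → Set
Intertwined f g s e t =
  ∀ u → g (to (bij (rot₈ ^Aut toℕ s)) u) ≡ to (bij (dihedral₄ e t)) (f u)

NoJump : (Fin 8 → Fin 4) → Set
NoJump f = ∀ u → f (next u) ≢ opp (f u)

-- Rotations of the peripheral cycle by at most 3 suffice: rotating by 4 acts on f as opp does.
spread-classification : ∀ a b c d → NoJump (spread a b c d) →
  (∀ x → ∃ λ u → spread a b c d u ≡ x) ×
  ∃ λ g → ∃ λ s → ∃ λ e → ∃ λ t → Intertwined (spread a b c d) (attachment g) s e t
spread-classification = from-yes (
  all? λ (a : Fin 4) → all? λ (b : Fin 4) → all? λ (c : Fin 4) → all? λ (d : Fin 4) →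
  all? (λ (u : Fin 8) → ¬? (spread a b c d (next u) ≟ᶠ opp (spread a b c d u)))
  →-dec
  (all? (λ (x : Fin 4) → any? λ (u : Fin 8) → spread a b c d u ≟ᶠ x)
   ×-dec
   any? λ (g : Fin 3) → any? λ (s : Fin 4) → any? λ (e : Fin 2) → any? λ (t : Fin 4) →
   all? λ (u : Fin 8) →
     attachment g (to (bij (rot₈ ^Aut toℕ s)) u)
     ≟ᶠ to (bij (dihedral₄ e t)) (spread a b c d u)))

-- Walks, distances and eccentricities.

module _ {n} (G : Graph n) where

  walk-snoc : ∀ {u v w k} → Walk G u v k → Adj G v w → Walk G u w (suc k)
  walk-snoc here       a = step a here
  walk-snoc (step b p) a = step b (walk-snoc p a)

  walk-reverse : ∀ {u v k} → Walk G u v k → Walk G v u k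
  walk-reverse here       = here
  walk-reverse (step a p) = walk-snoc (walk-reverse p) (trans (adj-sym G _ _) a)

  walk-++ : ∀ {u v w k l} → Walk G u v k → Walk G v w l → Walk G u w (k + l)
  walk-++ here       q = q
  walk-++ (step a p) q = step a (walk-++ p q)

  walk? : ∀ k u v → Dec (Walk G u v k)
  walk? zero u v with u ≟ᶠ v
  ... | yes refl = yes here
  ... | no  u≢v  = no λ { here → u≢v refl }
  walk? (suc k) u v with any? (λ w → (adj G u w ≟ᵇ true) ×-dec walk? k w v)
  ... | yes (w , a , p) = yes (step a p)
  ... | no  none        = no λ { (step a p) → none (_ , a , p) }

  Dist-unique : ∀ {u v k l} → Dist G u v k → Dist G u v l → k ≡ l
  Dist-unique (p , p-min) (q , q-min) = ≤-antisym (p-min _ q) (q-min _ p)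

  Ecc-unique : ∀ {v d e} → Ecc G v d → Ecc G v e → d ≡ e
  Ecc-unique (d-max , u , δu) (e-max , w , δw) =
    ≤-antisym (e-max _ _ δu) (d-max _ _ δw)

  -- Each membership in a metric subgraph carries its own radius or diameter. Uniqueness replaces
  -- these by the fixed `r` and `d`, so membership becomes a condition on `ecc`.
  module Levels {ecc : Fin n → ℕ} (isEcc : ∀ v → Ecc G v (ecc v))
                {r d : ℕ} (isRad : Rad G r) (isDiam : Diam G d) where

    Rad-unique : ∀ {s} → Rad G s → s ≡ r
    Rad-unique ((v , ev) , min) =
      ≤-antisym (min _ _ (proj₂ (proj₁ isRad))) (proj₂ isRad _ _ ev)

    Diam-unique : ∀ {s} → Diam G s → s ≡ d
    Diam-unique ((v , ev) , max) =
      ≤-antisym (proj₂ isDiam _ _ ev) (max _ _ (proj₂ (proj₁ isDiam)))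

    rad≤ecc : ∀ v → r ≤ ecc v
    rad≤ecc v = proj₂ isRad _ _ (isEcc v)

    ecc≤diam : ∀ v → ecc v ≤ d
    ecc≤diam v = proj₂ isDiam _ _ (isEcc v)

    Center⇒ : ∀ {v} → Center G v → ecc v ≡ r
    Center⇒ (s , isRad′ , e) = trans (Ecc-unique (isEcc _) e) (Rad-unique isRad′)

    ⇒Center : ∀ {v} → ecc v ≡ r → Center G v
    ⇒Center eq = r , isRad , subst (Ecc G _) eq (isEcc _)

    Periphery⇒ : ∀ {v} → Periphery G v → ecc v ≡ d
    Periphery⇒ (s , isDiam′ , e) = trans (Ecc-unique (isEcc _) e) (Diam-unique isDiam′)

    ⇒Periphery : ∀ {v} → ecc v ≡ d → Periphery G v
    ⇒Periphery eq = d , isDiam , subst (Ecc G _) eq (isEcc _)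

    Annulus⇒ : ∀ {v} → Annulus G v → r < ecc v × ecc v < d
    Annulus⇒ (s , t , e , isRad′ , isDiam′ , ev , s<e , e<t)
      rewrite Rad-unique isRad′ | Diam-unique isDiam′ | Ecc-unique ev (isEcc _) = s<e , e<t

    ⇒Annulus : ∀ {v} → r < ecc v → ecc v < d → Annulus G v
    ⇒Annulus r<e e<d = r , d , ecc _ , isRad , isDiam , isEcc _ , r<e , e<d

-- Applied to the decidable lengths of walks, this produces the distance.
least : ∀ {Q : ℕ → Set} → (∀ k → Dec (Q k)) → ∀ {k} → Q k →
        ∃ λ l → Q l × (∀ j → Q j → l ≤ j)
least {Q} Q? {k} q with Q? 0
... | yes q₀ = 0 , q₀ , λ _ _ → z≤n
least Q? {zero}  q | no ¬q₀ = contradiction q ¬q₀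
least {Q} Q? {suc k} q | no ¬q₀ with least {Q ∘ suc} (Q? ∘ suc) q
... | l , ql , min = suc l , ql ,
  λ { zero q₀ → contradiction q₀ ¬q₀ ; (suc j) qj → s≤s (min j qj) }

module Distance {n} (G : Graph n) (conn : Connected G) where

  abstract
    isDist : ∀ u v → ∃ (Dist G u v)
    isDist u v = least (λ k → walk? G k u v) (proj₂ (conn u v))

  δ : Fin n → Fin n → ℕ
  δ u v = proj₁ (isDist u v)

  δ-walk : ∀ u v → Walk G u v (δ u v)
  δ-walk u v = proj₁ (proj₂ (isDist u v))

  δ-min : ∀ {u v k} → Walk G u v k → δ u v ≤ k
  δ-min p = proj₂ (proj₂ (isDist _ _)) _ p

  abstract
    farthest : Fin n → Fin n
    -- The default `v` is itself a vertex, so the maximum is attained in the graph.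
    farthest v = argmax (δ v) v (allFin n)

    δ≤farthest : ∀ v u → δ v u ≤ δ v (farthest v)
    δ≤farthest v u = lookupAll (f[xs]≤f[argmax] {f = δ v} v (allFin n)) (∈-allFin u)

  ecc : Fin n → ℕ
  ecc v = δ v (farthest v)

  δ≤ecc : ∀ v u → δ v u ≤ ecc v
  δ≤ecc = δ≤farthest

  isEcc : ∀ v → Ecc G v (ecc v)
  isEcc v =
    (λ u k dist → subst (_≤ ecc v) (Dist-unique G (proj₂ (isDist v u)) dist) (δ≤ecc v u)) ,
    farthest v , proj₂ (isDist v (farthest v))

  -- Triangle inequality at the vertex farthest from `u`. It later excludes edges between center and
  -- periphery, whose eccentricities are 2 and 4.
  ecc-Adj : ∀ {u w} → Adj G u w → ecc u ≤ suc (ecc w)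
  ecc-Adj {u} {w} a =
    ≤-trans (δ-min (step a (δ-walk w (farthest u)))) (s≤s (δ≤ecc w (farthest u)))

-- The three graphs have the required metric subgraphs.

-- The shorter of the two arcs of a cycle of order `m`.
cycDist : ℕ → ℕ → ℕ → ℕ
cycDist m i j = ∣ i - j ∣ ⊓ (m ∸ ∣ i - j ∣)

-- A candidate for the distance: a path between peripheral vertices either stays on their cycle or
-- spends two edges to enter and leave the annulus. That no mixed path is shorter depends on `f` and
-- is left to the certificate.
distV : (Fin 8 → Fin 4) → V → V → ℕ
distV f (C i) (C j) = cycDist 3 (toℕ i) (toℕ j)
distV f (C i) (A a) = 1
distV f (C i) (P u) = 2
distV f (A a) (C i) = 1
distV f (A a) (A b) = cycDist 4 (toℕ a) (toℕ b)
distV f (A a) (P u) = suc (cycDist 4 (toℕ a) (toℕ (f u)))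
distV f (P u) (C i) = 2
distV f (P u) (A a) = suc (cycDist 4 (toℕ a) (toℕ (f u)))
distV f (P u) (P v) =
  cycDist 8 (toℕ u) (toℕ v) ⊓ (2 + cycDist 4 (toℕ (f u)) (toℕ (f v)))

levelV : V → ℕ
levelV (C _) = 2
levelV (A _) = 3
levelV (P _) = 4

dist : (Fin 8 → Fin 4) → Fin 15 → Fin 15 → ℕ
dist f x y = distV f (to code x) (to code y)

level : Fin 15 → ℕ
level x = levelV (to code x)

-- lipschitz bounds the length of a walk below by dist, descent produces a walk of that length.
record MetricCertificate (f : Fin 8 → Fin 4) : Set where
  field
    dist-refl  : ∀ x → dist f x x ≡ 0
    lipschitz  : ∀ x y → Adj (H f) x y → ∀ z → dist f x z ≤ suc (dist f y z)
    descent    : ∀ x z → x ≡ z ⊎ ∃ λ y → Adj (H f) x y × suc (dist f y z) ≡ dist f x z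
    dist≤level : ∀ x z → dist f x z ≤ level x
    attained   : ∀ x → ∃ λ z → dist f x z ≡ level x

attachment-certificate : ∀ g → MetricCertificate (attachment g)
attachment-certificate g = record
  { dist-refl  = from-yes (all? λ (g : Fin 3) → all? λ (x : Fin 15) →
      dist (attachment g) x x ≟ 0) g
  ; lipschitz  = from-yes (all? λ (g : Fin 3) → all? λ (x : Fin 15) → all? λ (y : Fin 15) →
      (adj (H (attachment g)) x y ≟ᵇ true) →-dec (all? λ (z : Fin 15) →
        dist (attachment g) x z ≤? suc (dist (attachment g) y z))) g
  ; descent    = from-yes (all? λ (g : Fin 3) → all? λ (x : Fin 15) → all? λ (z : Fin 15) →
      (x ≟ᶠ z) ⊎-dec (any? λ (y : Fin 15) → (adj (H (attachment g)) x y ≟ᵇ true)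
        ×-dec (suc (dist (attachment g) y z) ≟ dist (attachment g) x z))) g
  ; dist≤level = from-yes (all? λ (g : Fin 3) → all? λ (x : Fin 15) → all? λ (z : Fin 15) →
      dist (attachment g) x z ≤? level x) g
  ; attained   = from-yes (all? λ (g : Fin 3) → all? λ (x : Fin 15) → any? λ (z : Fin 15) →
      dist (attachment g) x z ≟ level x) g
  }

module Realisation {f : Fin 8 → Fin 4} (cert : MetricCertificate f) where
  open MetricCertificate cert

  dist-walk : ∀ k x z → dist f x z ≡ k → Walk (H f) x z k
  dist-walk k x z eq with descent x z
  dist-walk k       x z eq | inj₁ refl =
    subst (Walk (H f) x x) (trans (sym (dist-refl x)) eq) here
  dist-walk zero    x z eq | inj₂ (y , a , e) = contradiction (trans e eq) λ ()
  dist-walk (suc k) x z eq | inj₂ (y , a , e) =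
    step a (dist-walk k y z (suc-injective (trans e eq)))

  dist-min : ∀ {x z k} → Walk (H f) x z k → dist f x z ≤ k
  dist-min {x} here = ≤-reflexive (dist-refl x)
  dist-min {x} {z} (step {w = y} a p) = ≤-trans (lipschitz x y a z) (s≤s (dist-min p))

  isDist : ∀ x z → Dist (H f) x z (dist f x z)
  isDist x z = dist-walk _ x z refl , λ _ → dist-min

  connected : Connected (H f)
  connected x z = dist f x z , dist-walk _ x z refl

  isEcc : ∀ x → Ecc (H f) x (level x)
  isEcc x =
    (λ z k δ → subst (_≤ level x) (Dist-unique (H f) (isDist x z) δ) (dist≤level x z)) ,
    proj₁ (attained x) , subst (Dist (H f) x _) (proj₂ (attained x)) (isDist x _)

  level-unique : ∀ {x e} → Ecc (H f) x e → e ≡ level x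
  level-unique ε = Ecc-unique (H f) ε (isEcc _)

  isRad : Rad (H f) 2
  isRad = (from code (C zero) , isEcc _) ,
    λ x e ε → subst (2 ≤_) (sym (level-unique ε)) (2≤levelV (to code x))
    where
    2≤levelV : ∀ x → 2 ≤ levelV x
    2≤levelV (C _) = from-yes (2 ≤? 2)
    2≤levelV (A _) = from-yes (2 ≤? 3)
    2≤levelV (P _) = from-yes (2 ≤? 4)

  isDiam : Diam (H f) 4
  isDiam = (from code (P zero) , isEcc _) ,
    λ x e ε → subst (_≤ 4) (sym (level-unique ε)) (levelV≤4 (to code x))
    where
    levelV≤4 : ∀ x → levelV x ≤ 4
    levelV≤4 (C _) = from-yes (2 ≤? 4)
    levelV≤4 (A _) = from-yes (3 ≤? 4)
    levelV≤4 (P _) = from-yes (4 ≤? 4)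

  open Levels (H f) isEcc isRad isDiam

  level-from : ∀ x → level (from code x) ≡ levelV x
  level-from x = cong levelV (strictlyInverseˡ code x)

  -- Each metric subgraph is one summand of `V`; the round trips through `code` are settled here
  -- once for all three.
  inducedCycle : ∀ {k} {S : Fin 15 → Set} (embed : Fin (3 + k) → V) →
    Injective _≡_ _≡_ embed →
    (∀ i j → adjV f (embed i) (embed j) ≡ cyc i j) →
    (∀ x → S x → ∃ λ i → embed i ≡ to code x) →
    (∀ i → S (from code (embed i))) →
    InducedCycle (H f) S
  inducedCycle {k} embed embed-inj embed-adj cover sound =
    k , c ,
    (λ eq → embed-inj (trans (sym (strictlyInverseˡ code _))
      (trans (cong (to code) eq) (strictlyInverseˡ code _)))) ,
    (λ x s → proj₁ (cover x s) ,
      trans (cong (from code) (proj₂ (cover x s))) (strictlyInverseʳ code x)) ,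
    sound ,
    (λ i j a → does⇒ (cycAdj? i j) (trans (sym (c-adj i j)) a)) ,
    (λ i j a → trans (c-adj i j) (dec-true (cycAdj? i j) a))
    where
    c : Fin (3 + k) → Fin 15
    c i = from code (embed i)

    c-adj : ∀ i j → adj (H f) (c i) (c j) ≡ cyc i j
    c-adj i j = trans
      (cong₂ (adjV f) (strictlyInverseˡ code (embed i)) (strictlyInverseˡ code (embed j)))
      (embed-adj i j)

  metricCycles : MetricCycles (H f)
  metricCycles =
    inducedCycle inj₁ (λ { refl → refl }) (λ _ _ → refl)
      (λ x s → centerV (to code x) (Center⇒ s))
      (λ i → ⇒Center (level-from (C i))) ,
    inducedCycle (inj₂ ∘ inj₁) (λ { refl → refl }) (λ _ _ → refl)
      (λ x s → annulusV (to code x) (Annulus⇒ s))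
      (λ a → ⇒Annulus (subst (2 <_) (sym (level-from (A a))) (n<1+n 2))
                      (subst (_< 4) (sym (level-from (A a))) (n<1+n 3))) ,
    inducedCycle (inj₂ ∘ inj₂) (λ { refl → refl }) (λ _ _ → refl)
      (λ x s → peripheryV (to code x) (Periphery⇒ s))
      (λ u → ⇒Periphery (level-from (P u)))
    where
    centerV : ∀ x → levelV x ≡ 2 → ∃ λ i → C i ≡ x
    centerV (C i) _ = i , refl
    centerV (A _) ()
    centerV (P _) ()

    annulusV : ∀ x → 2 < levelV x × levelV x < 4 → ∃ λ a → A a ≡ x
    annulusV (C i) (2<2 , _) = contradiction refl (<⇒≢ 2<2)
    annulusV (A a) _         = a , refl
    annulusV (P u) (_ , 4<4) = contradiction refl (<⇒≢ 4<4)

    peripheryV : ∀ x → levelV x ≡ 4 → ∃ λ u → P u ≡ x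
    peripheryV (C _) ()
    peripheryV (A _) ()
    peripheryV (P u) _ = u , refl

-- Pairwise non-isomorphism.

-- The three graphs are told apart by their triangle-free vertices: G₂ has none, those of G₁ are
-- pairwise nonadjacent, and in G₃ the whole periphery is triangle-free.
InTriangle : ∀ {n} → Graph n → Fin n → Set
InTriangle G x = ∃ λ y → ∃ λ z → Adj G x y × Adj G y z × Adj G z x

inTriangle? : ∀ {n} (G : Graph n) x → Dec (InTriangle G x)
inTriangle? G x = any? λ y → any? λ z →
  (adj G x y ≟ᵇ true) ×-dec (adj G y z ≟ᵇ true) ×-dec (adj G z x ≟ᵇ true)

module _ {n} (G H : Graph n) (φ≅ : Iso G H) where
  private
    φ = proj₁ φ≅

  Iso-sym : Iso H G
  Iso-sym = ↔-sym φ , λ i j →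
    trans (sym (proj₂ φ≅ _ _)) (cong₂ (adj H) (strictlyInverseˡ φ i) (strictlyInverseˡ φ j))

  Iso-Adj : ∀ x y → Adj G x y → Adj H (to φ x) (to φ y)
  Iso-Adj x y a = trans (proj₂ φ≅ x y) a

  Iso-InTriangle : ∀ x → InTriangle G x → InTriangle H (to φ x)
  Iso-InTriangle x (y , z , a , b , c) =
    to φ y , to φ z , Iso-Adj x y a , Iso-Adj y z b , Iso-Adj z x c

Iso-InTriangle⁻ : ∀ {n} (G H : Graph n) (φ≅ : Iso G H) x →
                  InTriangle H (to (proj₁ φ≅) x) → InTriangle G x
Iso-InTriangle⁻ G H φ≅ x t = subst (InTriangle G) (strictlyInverseʳ (proj₁ φ≅) x)
  (Iso-InTriangle H G (Iso-sym G H φ≅) (to (proj₁ φ≅) x) t)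

Iso-trans : ∀ {n} (G H K : Graph n) → Iso G H → Iso H K → Iso G K
Iso-trans G H K (φ , φ≅) (ψ , ψ≅) = ψ ↔-∘ φ , λ i j → trans (ψ≅ _ _) (φ≅ i j)

TriangleFree : ∀ {n} → Graph n → Fin n → Set
TriangleFree G x = ¬ InTriangle G x

TriangleFreeEdge : ∀ {n} → Graph n → Set
TriangleFreeEdge G = ∃ λ x → ∃ λ y → Adj G x y × TriangleFree G x × TriangleFree G y

triangle-free-≇ : ∀ {n} (G H : Graph n) →
  ∃ (TriangleFree G) → (∀ x → InTriangle H x) → ¬ Iso G H
triangle-free-≇ G H (x , ¬t) t φ≅ = ¬t (Iso-InTriangle⁻ G H φ≅ x (t _))

triangle-free-edge-≇ : ∀ {n} (G H : Graph n) → TriangleFreeEdge G →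
  (∀ x y → Adj H x y → InTriangle H x ⊎ InTriangle H y) → ¬ Iso G H
triangle-free-edge-≇ G H (x , y , a , ¬tx , ¬ty) t φ≅ =
  [ (λ tx → ¬tx (Iso-InTriangle⁻ G H φ≅ x tx)) , (λ ty → ¬ty (Iso-InTriangle⁻ G H φ≅ y ty)) ]
  (t _ _ (Iso-Adj G H φ≅ x y a))

G₁ G₂ G₃ : Graph 15
G₁ = H (attachment (# 0))
G₂ = H (attachment (# 1))
G₃ = H (attachment (# 2))

G₂-triangles : ∀ x → InTriangle G₂ x
G₂-triangles = from-yes (all? (inTriangle? G₂))

G₁-triangle-free : ∃ (TriangleFree G₁)
G₁-triangle-free = from-yes (any? λ (x : Fin 15) → ¬? (inTriangle? G₁ x))

G₃-triangle-free-edge : TriangleFreeEdge G₃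
G₃-triangle-free-edge = from-yes (any? λ (x : Fin 15) → any? λ (y : Fin 15) →
  (adj G₃ x y ≟ᵇ true) ×-dec ¬? (inTriangle? G₃ x) ×-dec ¬? (inTriangle? G₃ y))

G₁-edges-meet-triangles : ∀ x y → Adj G₁ x y → InTriangle G₁ x ⊎ InTriangle G₁ y
G₁-edges-meet-triangles = from-yes (all? λ (x : Fin 15) → all? λ (y : Fin 15) →
  (adj G₁ x y ≟ᵇ true) →-dec (inTriangle? G₁ x ⊎-dec inTriangle? G₁ y))

G₃-triangle-free : ∃ (TriangleFree G₃)
G₃-triangle-free = from-yes (any? λ (x : Fin 15) → ¬? (inTriangle? G₃ x))

G₁≇G₂ : ¬ Iso G₁ G₂
G₁≇G₂ = triangle-free-≇ G₁ G₂ G₁-triangle-free G₂-triangles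

G₁≇G₃ : ¬ Iso G₁ G₃
G₁≇G₃ φ≅ = triangle-free-edge-≇ G₃ G₁ G₃-triangle-free-edge G₁-edges-meet-triangles
  (Iso-sym G₁ G₃ φ≅)

G₂≇G₃ : ¬ Iso G₂ G₃
G₂≇G₃ φ≅ = triangle-free-≇ G₃ G₂ G₃-triangle-free G₂-triangles (Iso-sym G₂ G₃ φ≅)

-- The size as an isomorphism invariant.

sum-tabulate : ∀ {n} (f : Fin n → ℕ) → sum (tabulate f) ≡ ∑ f
sum-tabulate {zero}  f = refl
sum-tabulate {suc n} f = cong (f zero +_) (sum-tabulate (f ∘ suc))

sum-allFin : ∀ {n} (f : Fin n → ℕ) → sum (map f (allFin n)) ≡ ∑ f
sum-allFin f = trans (cong sum (map-tabulate id f)) (sum-tabulate f)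

degreeSum : ∀ {n} → Graph n → ℕ
degreeSum G = ∑ λ i → ∑ λ j → if adj G i j then 1 else 0

module _ {n} (G : Graph n) where

  edge : Fin n → Fin n → ℕ
  edge i j = if (toℕ i <ᵇ toℕ j) ∧ adj G i j then 1 else 0

  size-∑ : size G ≡ ∑ λ i → ∑ (edge i)
  size-∑ = trans (sum-allFin (λ i → sum (map (edge i) (allFin n))))
    (sum-cong-≗ λ i → sum-allFin (edge i))

  edge-< : ∀ {i j} → toℕ i < toℕ j → edge i j + edge j i ≡ (if adj G i j then 1 else 0)
  edge-< {i} {j} i<j
    rewrite dec-true (toℕ i <? toℕ j) i<j | dec-false (toℕ j <? toℕ i) (<⇒≯ i<j)
    = +-identityʳ _

  edge-symmetrised : ∀ i j → edge i j + edge j i ≡ (if adj G i j then 1 else 0)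
  edge-symmetrised i j with <-cmp (toℕ i) (toℕ j)
  ... | tri< i<j _ _ = edge-< i<j
  ... | tri> _ _ j<i = trans (+-comm (edge i j) (edge j i))
    (trans (edge-< j<i) (cong (if_then 1 else 0) (adj-sym G j i)))
  ... | tri≈ _ i≡j _ with toℕ-injective i≡j
  ...   | refl rewrite dec-false (toℕ i <? toℕ i) (n≮n (toℕ i)) | irrefl G i = refl

  -- The formula for `size` selects pairs by the numbering of the vertices. Adding its transpose
  -- removes this choice, and the resulting degree sum is visibly unchanged by a permutation.
  handshake : size G + size G ≡ degreeSum G
  handshake = begin
    size G + size G                            ≡⟨ cong₂ _+_ size-∑ (trans size-∑ (∑-comm edge)) ⟩
    ∑ (λ i → ∑ (edge i)) + ∑ (λ i → ∑ λ j → edge j i)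
      ≡⟨ ∑-distrib-+ (λ i → ∑ (edge i)) (λ i → ∑ λ j → edge j i) ⟨
    ∑ (λ i → ∑ (edge i) + ∑ λ j → edge j i)    ≡⟨ (sum-cong-≗ λ i → ∑-distrib-+ (edge i) (λ j → edge j i)) ⟨
    ∑ (λ i → ∑ λ j → edge i j + edge j i)      ≡⟨ (sum-cong-≗ λ i → sum-cong-≗ (edge-symmetrised i)) ⟩
    degreeSum G                                ∎
    where open ≡-Reasoning

double-injective : ∀ m n → m + m ≡ n + n → m ≡ n
double-injective m n eq = *-cancelˡ-≡ m n 2
  (trans (cong (m +_) (+-identityʳ m)) (trans eq (cong (n +_) (sym (+-identityʳ n)))))

degreeSum-Iso : ∀ {n} (G H : Graph n) → Iso G H → degreeSum G ≡ degreeSum H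
degreeSum-Iso G H (φ , φ≅) = begin
  (∑ λ i → ∑ λ j → if adj G i j then 1 else 0)
    ≡⟨ (sum-cong-≗ λ i → sum-cong-≗ λ j → cong (if_then 1 else 0) (φ≅ i j)) ⟨
  (∑ λ i → ∑ λ j → if adj H (to φ i) (to φ j) then 1 else 0)
    ≡⟨ (sum-cong-≗ λ i → ∑-permute (λ j → if adj H (to φ i) j then 1 else 0) φ) ⟨
  (∑ λ i → ∑ λ j → if adj H (to φ i) j then 1 else 0)
    ≡⟨ ∑-permute (λ i → ∑ λ j → if adj H i j then 1 else 0) φ ⟨
  degreeSum H ∎
  where open ≡-Reasoning

size-Iso : ∀ {n} (G H : Graph n) → Iso G H → size G ≡ size H
size-Iso G H φ≅ = double-injective _ _
  (trans (handshake G) (trans (degreeSum-Iso G H φ≅) (sym (handshake H))))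

size-attachment : ∀ g → size (H (attachment g)) ≡ 35
size-attachment = from-yes (all? λ (g : Fin 3) → size (H (attachment g)) ≟ 35)

-- Arcs of induced cycles.

-- `InducedCycle` with the length as a parameter, so that the length can be specialised once it has
-- been computed.
record CycleOn {n} (G : Graph n) (S : Fin n → Set) (k : ℕ) : Set where
  field
    vertex    : Fin (3 + k) → Fin n
    injective : Injective _≡_ _≡_ vertex
    covers    : ∀ x → S x → ∃ λ i → vertex i ≡ x
    sound     : ∀ i → S (vertex i)
    Adj⇒      : ∀ i j → Adj G (vertex i) (vertex j) → CycAdj i j
    ⇒Adj      : ∀ i j → CycAdj i j → Adj G (vertex i) (vertex j)

toCycleOn : ∀ {n} {G : Graph n} {S} → InducedCycle G S → ∃ (CycleOn G S)
toCycleOn (k , c , inj , cov , sd , adj⇒ , ⇒adj) = k , record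
  { vertex = c ; injective = inj ; covers = cov ; sound = sd ; Adj⇒ = adj⇒ ; ⇒Adj = ⇒adj }

CycAdj-next : ∀ {k} (i : Fin (3 + k)) → CycAdj i (next i)
CycAdj-next {k} i = inj₁ (toℕ-fromℕ< (m%n<n (suc (toℕ i)) (3 + k)))

module Arcs {n} {G : Graph n} {S k} (cycle : CycleOn G S k) where
  open CycleOn cycle

  -- Stating the endpoint modulo the order lets the walk run past the end of the numbering without a
  -- case distinction.
  arc-walk : ∀ l i j → toℕ j ≡ (toℕ i + l) % (3 + k) → Walk G (vertex i) (vertex j) l
  arc-walk zero i j eq = subst (λ x → Walk G (vertex i) (vertex x) 0) (toℕ-injective (begin
    toℕ i                  ≡⟨ m<n⇒m%n≡m (toℕ<n i) ⟨
    toℕ i % (3 + k)        ≡⟨ cong (_% (3 + k)) (+-identityʳ (toℕ i)) ⟨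
    (toℕ i + 0) % (3 + k)  ≡⟨ eq ⟨
    toℕ j                  ∎)) here
    where open ≡-Reasoning
  arc-walk (suc l) i j eq = step (⇒Adj i (next i) (CycAdj-next i)) (arc-walk l (next i) j (begin
    toℕ j                                    ≡⟨ eq ⟩
    (toℕ i + suc l) % m                      ≡⟨ cong (_% m) (+-suc (toℕ i) l) ⟩
    (suc (toℕ i) + l) % m                    ≡⟨ %-distribˡ-+ (suc (toℕ i)) l m ⟩
    (suc (toℕ i) % m + l % m) % m            ≡⟨ cong (λ x → (x + l % m) % m) (m%n%n≡m%n (suc (toℕ i)) m) ⟨
    (suc (toℕ i) % m % m + l % m) % m        ≡⟨ %-distribˡ-+ (suc (toℕ i) % m) l m ⟨
    (suc (toℕ i) % m + l) % m                ≡⟨ cong (λ x → (x + l) % m) (toℕ-fromℕ< (m%n<n (suc (toℕ i)) m)) ⟨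
    (toℕ (next i) + l) % m                   ∎))
    where
    open ≡-Reasoning
    m = 3 + k

  arcs-≤ : ∀ i j → toℕ i ≤ toℕ j →
    Walk G (vertex i) (vertex j) (toℕ j ∸ toℕ i) ×
    Walk G (vertex i) (vertex j) (3 + k ∸ (toℕ j ∸ toℕ i))
  arcs-≤ i j i≤j =
    arc-walk _ i j (begin
      toℕ j                          ≡⟨ m<n⇒m%n≡m (toℕ<n j) ⟨
      toℕ j % m                      ≡⟨ cong (_% m) (m+[n∸m]≡n i≤j) ⟨
      (toℕ i + (toℕ j ∸ toℕ i)) % m  ∎) ,
    -- The complementary arc goes forward from `j`, wraps around to `i`, and is then reversed.
    walk-reverse G (arc-walk _ j i (begin
      toℕ i                                ≡⟨ m<n⇒m%n≡m (toℕ<n i) ⟨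
      toℕ i % m                            ≡⟨ [m+n]%n≡m%n (toℕ i) m ⟨
      (toℕ i + m) % m                      ≡⟨ cong (λ x → (toℕ i + x) % m) (m+[n∸m]≡n gap≤m) ⟨
      (toℕ i + (gap + (m ∸ gap))) % m      ≡⟨ cong (_% m) (+-assoc (toℕ i) _ _) ⟨
      (toℕ i + gap + (m ∸ gap)) % m        ≡⟨ cong (λ x → (x + (m ∸ gap)) % m) (m+[n∸m]≡n i≤j) ⟩
      (toℕ j + (m ∸ gap)) % m              ∎))
    where
    open ≡-Reasoning
    m = 3 + k
    gap = toℕ j ∸ toℕ i

    gap≤m : gap ≤ m
    gap≤m = ≤-trans (m∸n≤m (toℕ j) (toℕ i)) (<⇒≤ (toℕ<n j))

  arcs : ∀ i j →
    Walk G (vertex i) (vertex j) ∣ toℕ i - toℕ j ∣ ×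
    Walk G (vertex i) (vertex j) (3 + k ∸ ∣ toℕ i - toℕ j ∣)
  arcs i j with ≤-total (toℕ i) (toℕ j)
  ... | inj₁ i≤j rewrite m≤n⇒∣m-n∣≡n∸m i≤j = arcs-≤ i j i≤j
  ... | inj₂ j≤i rewrite m≤n⇒∣n-m∣≡n∸m j≤i =
    walk-reverse G (proj₁ (arcs-≤ j i j≤i)) , walk-reverse G (proj₂ (arcs-≤ j i j≤i))

-- In a triangle any two vertices are equal or adjacent.
two-apart⇒4≤order : ∀ {k} (a b : Fin (3 + k)) → ¬ (a ≡ b ⊎ CycAdj a b) → 1 ≤ k
two-apart⇒4≤order {zero} a b apart = contradiction
  (from-yes (all? λ (a : Fin 3) → all? λ (b : Fin 3) → (a ≟ᶠ b) ⊎-dec cycAdj? a b) a b) apart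
two-apart⇒4≤order {suc k} a b apart = s≤s z≤n

-- Radius, diameter and the lower bound on the order.

module Structure {n} (G : Graph n) (conn : Connected G) {kC kA kP}
  (cycleC : CycleOn G (Center G) kC)
  (cycleA : CycleOn G (Annulus G) kA)
  (cycleP : CycleOn G (Periphery G) kP) where

  open Distance G conn
  open CycleOn cycleC using () renaming (vertex to vC)
  open CycleOn cycleA using () renaming (vertex to vA)
  open CycleOn cycleP using () renaming (vertex to vP)

  -- Read off from the membership proofs of one central and one peripheral vertex.
  r d : ℕ
  r = proj₁ (CycleOn.sound cycleC zero)
  d = proj₁ (CycleOn.sound cycleP zero)

  open Levels G isEcc (proj₁ (proj₂ (CycleOn.sound cycleC zero)))
                      (proj₁ (proj₂ (CycleOn.sound cycleP zero)))

  ecc-C : ∀ i → ecc (vC i) ≡ r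
  ecc-C i = Center⇒ (CycleOn.sound cycleC i)

  ecc-A : ∀ a → r < ecc (vA a) × ecc (vA a) < d
  ecc-A a = Annulus⇒ (CycleOn.sound cycleA a)

  ecc-P : ∀ u → ecc (vP u) ≡ d
  ecc-P u = Periphery⇒ (CycleOn.sound cycleP u)

  r+2≤d : 2 + r ≤ d
  r+2≤d = ≤-trans (s≤s (proj₁ (ecc-A zero))) (proj₂ (ecc-A zero))

  -- A peripheral vertex and its farthest vertex are joined through a central one.
  d≤2r : d ≤ r + r
  d≤2r = begin
    d                                ≡⟨ ecc-P zero ⟨
    δ u (farthest u)                 ≤⟨ δ-min (walk-++ G (walk-reverse G (δ-walk c u)) (δ-walk c (farthest u))) ⟩
    δ c u + δ c (farthest u)         ≤⟨ +-mono-≤ (δ≤ecc c u) (δ≤ecc c (farthest u)) ⟩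
    ecc c + ecc c                    ≡⟨ cong₂ _+_ (ecc-C zero) (ecc-C zero) ⟩
    r + r                            ∎
    where
    open ≤-Reasoning
    u = vP zero
    c = vC zero

  2≤r : 2 ≤ r
  2≤r = +-cancelʳ-≤ r 2 r (≤-trans r+2≤d d≤2r)

  -- The vertex farthest from a peripheral vertex has eccentricity at least `d`, so it is peripheral
  -- too and lies on the cycle.
  opposite : ∀ u → ∃ λ v → δ (vP u) (vP v) ≡ d
  opposite u with CycleOn.covers cycleP (farthest (vP u)) (⇒Periphery (≤-antisym (ecc≤diam _) d≤ecc))
    where
    d≤ecc : d ≤ ecc (farthest (vP u))
    d≤ecc = begin
      d                                ≡⟨ ecc-P u ⟨
      δ (vP u) (farthest (vP u))       ≤⟨ δ-min (walk-reverse G (δ-walk _ _)) ⟩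
      δ (farthest (vP u)) (vP u)       ≤⟨ δ≤ecc _ _ ⟩
      ecc (farthest (vP u))            ∎
      where open ≤-Reasoning
  ... | v , eq = v , trans (cong (δ (vP u)) eq) (ecc-P u)

  δ-arcs : ∀ {u v l} → δ (vP u) (vP v) ≡ l →
    l ≤ ∣ toℕ u - toℕ v ∣ × l ≤ 3 + kP ∸ ∣ toℕ u - toℕ v ∣
  δ-arcs {u} {v} refl =
    δ-min (proj₁ (Arcs.arcs cycleP u v)) , δ-min (proj₂ (Arcs.arcs cycleP u v))

  gap≤order : ∀ (u v : Fin (3 + kP)) → ∣ toℕ u - toℕ v ∣ ≤ 3 + kP
  gap≤order u v =
    ≤-trans (∣m-n∣≤m⊔n (toℕ u) (toℕ v)) (⊔-lub (<⇒≤ (toℕ<n u)) (<⇒≤ (toℕ<n v)))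

  -- Two vertices at distance `d` cut the peripheral cycle into two arcs, and neither is shorter
  -- than `d`.
  2d≤|P| : d + d ≤ 3 + kP
  2d≤|P| = let v , eq = opposite zero ; l₁ , l₂ = δ-arcs eq in begin
    d + d                                              ≤⟨ +-mono-≤ l₁ l₂ ⟩
    ∣ 0 - toℕ v ∣ + (3 + kP ∸ ∣ 0 - toℕ v ∣)           ≡⟨ m+[n∸m]≡n (gap≤order zero v) ⟩
    3 + kP                                             ∎
    where open ≤-Reasoning

  label : Fin (3 + kC) ⊎ Fin (3 + kA) ⊎ Fin (3 + kP) → Fin n
  label = [ vC , [ vA , vP ] ]

  r<d : r < d
  r<d = ≤-trans (n≤1+n _) r+2≤d

  C≢A : ∀ {i a} → vC i ≢ vA a
  C≢A {i} {a} eq = <⇒≢ (proj₁ (ecc-A a)) (trans (sym (ecc-C i)) (cong ecc eq))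

  C≢P : ∀ {i u} → vC i ≢ vP u
  C≢P {i} {u} eq = <⇒≢ r<d (trans (sym (ecc-C i)) (trans (cong ecc eq) (ecc-P u)))

  A≢P : ∀ {a u} → vA a ≢ vP u
  A≢P {a} {u} eq = <⇒≢ (proj₂ (ecc-A a)) (trans (cong ecc eq) (ecc-P u))

  label-injective : Injective _≡_ _≡_ label
  label-injective {C i} {C j} eq = cong inj₁ (CycleOn.injective cycleC eq)
  label-injective {A a} {A b} eq = cong (inj₂ ∘ inj₁) (CycleOn.injective cycleA eq)
  label-injective {P u} {P v} eq = cong (inj₂ ∘ inj₂) (CycleOn.injective cycleP eq)
  label-injective {C i} {A a} eq = contradiction eq C≢A
  label-injective {A a} {C i} eq = contradiction (sym eq) C≢A
  label-injective {C i} {P u} eq = contradiction eq C≢P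
  label-injective {P u} {C i} eq = contradiction (sym eq) C≢P
  label-injective {A a} {P u} eq = contradiction eq A≢P
  label-injective {P u} {A a} eq = contradiction (sym eq) A≢P

  label-surjective : ∀ x → ∃ λ y → label y ≡ x
  label-surjective x with ecc x ≟ r | ecc x ≟ d
  ... | yes e≡r | _       = let i , eq = CycleOn.covers cycleC x (⇒Center e≡r) in C i , eq
  ... | no  _   | yes e≡d = let u , eq = CycleOn.covers cycleP x (⇒Periphery e≡d) in P u , eq
  ... | no  e≢r | no  e≢d =
    let a , eq = CycleOn.covers cycleA x
                   (⇒Annulus (≤∧≢⇒< (rad≤ecc x) (e≢r ∘ sym)) (≤∧≢⇒< (ecc≤diam x) e≢d))
    in A a , eq

  orders≤n : (3 + kC) + ((3 + kA) + (3 + kP)) ≤ n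
  orders≤n = injective⇒≤ λ eq → Injection.injective (↔⇒↣ decode) (label-injective eq)
    where
    decode : Fin ((3 + kC) + ((3 + kA) + (3 + kP))) ↔ (Fin (3 + kC) ⊎ Fin (3 + kA) ⊎ Fin (3 + kP))
    decode = (↔-id _ ⊎-↔ +↔⊎) ↔-∘ +↔⊎

  module Tight (r≡2 : r ≡ 2) (d≡4 : d ≡ 4) where

    -- A shortest walk from `vC i` to `vP u` has length at most 2. The eccentricities 2 and 4 rule
    -- out lengths 0 and 1, and they force eccentricity 3 on the middle vertex.
    link : ∀ u i → ∃ λ a → Adj G (vP u) (vA a) × Adj G (vC i) (vA a)
    link u i = through (δ-walk (vC i) (vP u)) refl refl
                 (≤-trans (δ≤ecc _ _) (≤-reflexive (trans (ecc-C i) r≡2)))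
      where
      -- The endpoints are variables tied by equations so that the walk can be split into cases.
      through : ∀ {x y l} → Walk G x y l → x ≡ vC i → y ≡ vP u → l ≤ 2 →
                ∃ λ a → Adj G (vP u) (vA a) × Adj G (vC i) (vA a)
      through here refl eq _ = contradiction eq C≢P
      through (step a here) refl refl _ = contradiction
        (subst₂ (λ e e′ → e ≤ suc e′) (trans (ecc-P u) d≡4) (trans (ecc-C i) r≡2)
          (ecc-Adj (trans (adj-sym G _ _) a)))
        (from-no (4 ≤? 3))
      through (step {w = w} a (step b here)) refl refl _ =
        let x , eq = CycleOn.covers cycleA w (⇒Annulus r<e e<d) in
        x , trans (cong (adj G (vP u)) eq) (trans (adj-sym G _ _) b) ,
        trans (cong (adj G (vC i)) eq) a
        where
        r<e : r < ecc w
        r<e = subst (_< ecc w) (sym r≡2) (s≤s⁻¹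
          (subst (_≤ suc (ecc w)) (trans (ecc-P u) d≡4) (ecc-Adj (trans (adj-sym G _ _) b))))

        e<d : ecc w < d
        e<d = subst (ecc w <_) (sym d≡4) (s≤s
          (subst (λ e → ecc w ≤ suc e) (trans (ecc-C i) r≡2) (ecc-Adj (trans (adj-sym G _ _) a))))
      through (step _ (step _ (step _ _))) _ _ (s≤s (s≤s ()))

    -- Equal or adjacent annular neighbours would give a walk of length 2 or 3 between vertices at
    -- distance 4.
    attachments-apart : ∀ {u v} → δ (vP u) (vP v) ≡ d → ∀ {a b} →
      Adj G (vP u) (vA a) → Adj G (vP v) (vA b) → ¬ (a ≡ b ⊎ CycAdj a b)
    attachments-apart {u} {v} far p q (inj₁ refl) = contradiction
      (subst (_≤ 2) (trans far d≡4) (δ-min (step p (step (trans (adj-sym G _ _) q) here))))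
      (from-no (4 ≤? 2))
    attachments-apart {u} {v} far {a} {b} p q (inj₂ ab) = contradiction
      (subst (_≤ 3) (trans far d≡4)
        (δ-min (step p (step (CycleOn.⇒Adj cycleA a b ab) (step (trans (adj-sym G _ _) q) here)))))
      (from-no (4 ≤? 3))

    4≤|A| : 1 ≤ kA
    4≤|A| =
      let v , far = opposite zero
          a , p , _ = link zero zero
          b , q , _ = link v zero
      in two-apart⇒4≤order a b (attachments-apart far p q)

  record Shape : Set where
    field
      r≡2  : r ≡ 2
      d≡4  : d ≡ 4
      kC≡0 : kC ≡ 0
      kA≡1 : kA ≡ 1
      kP≡5 : kP ≡ 5

  -- Three triangles already use 9 vertices, so the excesses `kC`, `kA`, `kP` sum to at most 6. The
  -- bounds `5 ≤ kP` and `1 ≤ kA` exhaust this budget.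
  shape : n ≤ 15 → Shape
  shape n≤15 = record
    { r≡2 = r≡2 ; d≡4 = d≡4
    ; kC≡0 = n≤0⇒n≡0 (+-cancelʳ-≤ 6 kC 0 (≤-trans (+-monoʳ-≤ kC (+-mono-≤ 1≤kA 5≤kP)) k≤6))
    ; kA≡1 = ≤-antisym
        (+-cancelʳ-≤ 5 kA 1 (≤-trans (+-monoʳ-≤ kA 5≤kP) (m+n≤o⇒n≤o kC k≤6))) 1≤kA
    ; kP≡5 = ≤-antisym
        (+-cancelˡ-≤ 1 kP 5 (≤-trans (+-monoˡ-≤ kP 1≤kA) (m+n≤o⇒n≤o kC k≤6))) 5≤kP
    }
    where
    regroup : ∀ c a p → (3 + c) + ((3 + a) + (3 + p)) ≡ 9 + (c + (a + p))
    regroup = solve-∀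

    k≤6 : kC + (kA + kP) ≤ 6
    k≤6 = +-cancelˡ-≤ 9 _ 6
      (≤-trans (≤-reflexive (sym (regroup kC kA kP))) (≤-trans orders≤n n≤15))

    d≤4 : d ≤ 4
    -- Otherwise the peripheral cycle has order at least 10, so `kP` is at least 7 and exceeds the
    -- budget.
    d≤4 = ≮⇒≥ λ 5≤d → contradiction
      (≤-trans (s≤s⁻¹ (s≤s⁻¹ (s≤s⁻¹ (≤-trans (+-mono-≤ 5≤d 5≤d) 2d≤|P|))))
        (m+n≤o⇒n≤o kA (m+n≤o⇒n≤o kC k≤6)))
      (from-no (7 ≤? 6))

    d≡4 : d ≡ 4
    d≡4 = ≤-antisym d≤4 (≤-trans (s≤s (s≤s 2≤r)) r+2≤d)

    r≡2 : r ≡ 2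
    r≡2 = ≤-antisym (s≤s⁻¹ (s≤s⁻¹ (≤-trans r+2≤d d≤4))) 2≤r

    5≤kP : 5 ≤ kP
    5≤kP = s≤s⁻¹ (s≤s⁻¹ (s≤s⁻¹ (subst (λ x → x + x ≤ 3 + kP) d≡4 2d≤|P|)))

    1≤kA : 1 ≤ kA
    1≤kA = Tight.4≤|A| r≡2 d≡4

  -- If `n ≤ 15`, the shape is forced and `orders≤n` reads `3 + (4 + 8) ≤ n`.
  15≤n : 15 ≤ n
  15≤n with ≤-total 15 n
  ... | inj₁ 15≤n = 15≤n
  ... | inj₂ n≤15 with shape n≤15
  ...   | record { kC≡0 = refl ; kA≡1 = refl ; kP≡5 = refl } = orders≤n

-- Order 15: reduction to the attachment map.

-- The center is joined to the whole annulus and to no peripheral vertex, so fixing it pointwise is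
-- compatible with any motions of the other two cycles. The hypothesis handles the edges between
-- annulus and periphery.
Intertwined⇒Iso : ∀ {f g s e t} → Intertwined f g s e t → Iso (H f) (H g)
Intertwined⇒Iso {f} {g} {s} {e} {t} gσ≡τf =
  (↔-sym code ↔-∘ ψ) ↔-∘ code , λ i j → trans
    (cong₂ (adjV g) (strictlyInverseˡ code (to ψ (to code i)))
                    (strictlyInverseˡ code (to ψ (to code j))))
    (ψ-adj (to code i) (to code j))
  where
  σ = rot₈ ^Aut toℕ s
  τ = dihedral₄ e t

  ψ : V ↔ V
  ψ = ↔-id _ ⊎-↔ (bij τ ⊎-↔ bij σ)

  attached : ∀ u a → does (g (to (bij σ) u) ≟ᶠ to (bij τ) a) ≡ does (f u ≟ᶠ a)
  attached u a = ≡true-ext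
    (λ eq → dec-true (f u ≟ᶠ a) (Injection.injective (↔⇒↣ (bij τ))
      (trans (sym (gσ≡τf u)) (does⇒ (g (to (bij σ) u) ≟ᶠ to (bij τ) a) eq))))
    (λ eq → dec-true (g (to (bij σ) u) ≟ᶠ to (bij τ) a)
      (trans (gσ≡τf u) (cong (to (bij τ)) (does⇒ (f u ≟ᶠ a) eq))))

  ψ-adj : ∀ x y → adjV g (to ψ x) (to ψ y) ≡ adjV f x y
  ψ-adj (C i) (C j) = refl
  ψ-adj (C i) (A a) = refl
  ψ-adj (C i) (P u) = refl
  ψ-adj (A a) (C i) = refl
  ψ-adj (A a) (A b) = pres τ a b
  ψ-adj (A a) (P u) = attached u a
  ψ-adj (P u) (C i) = refl
  ψ-adj (P u) (A a) = attached u a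
  ψ-adj (P u) (P v) = pres σ u v

opp-unique : ∀ (a b : Fin 4) → ¬ (a ≡ b ⊎ CycAdj a b) → b ≡ opp a
opp-unique = from-yes (all? λ (a : Fin 4) → all? λ (b : Fin 4) →
  ¬? ((a ≟ᶠ b) ⊎-dec cycAdj? a b) →-dec (b ≟ᶠ opp a))

opp-involutive : ∀ a → opp (opp a) ≡ a
opp-involutive = from-yes (all? λ (a : Fin 4) → opp (opp a) ≟ᶠ a)

-- Two arcs of length at least 4 in an 8-cycle both have length exactly 4.
antipode-unique : ∀ (u v : Fin 8) →
  4 ≤ ∣ toℕ u - toℕ v ∣ × 4 ≤ 8 ∸ ∣ toℕ u - toℕ v ∣ → v ≡ antipode u
antipode-unique = from-yes (all? λ (u : Fin 8) → all? λ (v : Fin 8) →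
  ((4 ≤? ∣ toℕ u - toℕ v ∣) ×-dec (4 ≤? 8 ∸ ∣ toℕ u - toℕ v ∣)) →-dec (v ≟ᶠ antipode u))

spread-η : ∀ (f : Fin 8 → Fin 4) → (∀ u → f (antipode u) ≡ opp (f u)) →
  ∀ u → spread (f (# 0)) (f (# 1)) (f (# 2)) (f (# 3)) u ≡ f u
spread-η f f-antipode zero = refl
spread-η f f-antipode (suc zero) = refl
spread-η f f-antipode (suc (suc zero)) = refl
spread-η f f-antipode (suc (suc (suc zero))) = refl
spread-η f f-antipode (suc (suc (suc (suc zero)))) = sym (f-antipode (# 0))
spread-η f f-antipode (suc (suc (suc (suc (suc zero))))) = sym (f-antipode (# 1))
spread-η f f-antipode (suc (suc (suc (suc (suc (suc zero)))))) = sym (f-antipode (# 2))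
spread-η f f-antipode (suc (suc (suc (suc (suc (suc (suc zero))))))) = sym (f-antipode (# 3))

-- By the antipodal relation `f` agrees pointwise with the `spread` of its first four values, so the
-- result of the finite search carries over.
classification : ∀ (f : Fin 8 → Fin 4) → (∀ u → f (antipode u) ≡ opp (f u)) → NoJump f →
  (∀ x → ∃ λ u → f u ≡ x) × ∃ λ g → Iso (H f) (H (attachment g))
classification f f-antipode noJump =
  transfer (spread-classification (f (# 0)) (f (# 1)) (f (# 2)) (f (# 3))
    λ u eq → noJump u (trans (sym (η (next u))) (trans eq (cong opp (η u)))))
  where
  f′ = spread (f (# 0)) (f (# 1)) (f (# 2)) (f (# 3))
  η = spread-η f f-antipode

  transfer :
    (∀ x → ∃ λ u → f′ u ≡ x) ×
    (∃ λ g → ∃ λ s → ∃ λ e → ∃ λ t → Intertwined f′ (attachment g) s e t) →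
    (∀ x → ∃ λ u → f u ≡ x) × ∃ λ g → Iso (H f) (H (attachment g))
  transfer (surjective , g , s , e , t , gσ≡τf) =
    (λ x → let u , eq = surjective x in u , trans (sym (η u)) eq) ,
    g , Intertwined⇒Iso {f} {attachment g} {s} {e} {t}
          λ u → trans (gσ≡τf u) (cong (to (bij (dihedral₄ e t))) (η u))

module Order15 (G : Graph 15) (conn : Connected G)
  (cycleC : CycleOn G (Center G) 0)
  (cycleA : CycleOn G (Annulus G) 1)
  (cycleP : CycleOn G (Periphery G) 5) where

  open Distance G conn
  open Structure G conn cycleC cycleA cycleP
  open Shape (shape ≤-refl) using (r≡2; d≡4)
  open Tight r≡2 d≡4
  open CycleOn cycleC using () renaming (vertex to vC)
  open CycleOn cycleA using () renaming (vertex to vA)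
  open CycleOn cycleP using () renaming (vertex to vP)

  Adj-sym : ∀ {x y} → Adj G x y → Adj G y x
  Adj-sym a = trans (adj-sym G _ _) a

  antipode-far : ∀ u → δ (vP u) (vP (antipode u)) ≡ d
  antipode-far u = let v , far = opposite u in
    subst (λ v → δ (vP u) (vP v) ≡ d) (antipode-unique u v (δ-arcs (trans far d≡4))) far

  -- The annular vertex on a path to the central vertex `vC zero`; `f-unique` shows that no other
  -- choice was possible.
  f : Fin 8 → Fin 4
  f u = proj₁ (link u zero)

  f-Adj : ∀ u → Adj G (vP u) (vA (f u))
  f-Adj u = proj₁ (proj₂ (link u zero))

  antipodal-attachments : ∀ {u a b} →
    Adj G (vP u) (vA a) → Adj G (vP (antipode u)) (vA b) → b ≡ opp a
  antipodal-attachments {u} {a} {b} p q =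
    opp-unique a b (attachments-apart (antipode-far u) p q)

  f-antipode : ∀ u → f (antipode u) ≡ opp (f u)
  f-antipode u = antipodal-attachments (f-Adj u) (f-Adj (antipode u))

  -- Both `f u` and `a` must be opposite to the attachment of the antipode.
  f-unique : ∀ {u a} → Adj G (vP u) (vA a) → f u ≡ a
  f-unique {u} {a} p = begin
    f u                ≡⟨ opp-involutive (f u) ⟨
    opp (opp (f u))    ≡⟨ cong opp (f-antipode u) ⟨
    opp (f (antipode u)) ≡⟨ cong opp (antipodal-attachments p (f-Adj (antipode u))) ⟩
    opp (opp a)        ≡⟨ opp-involutive a ⟩
    a                  ∎
    where open ≡-Reasoning

  -- After a jump `next u` would share its annular neighbour with the antipode of `u`, giving a walk
  -- of length 3 from `u` to its antipode.
  f-noJump : NoJump f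
  f-noJump u eq = contradiction
    (subst (_≤ 3) (trans (antipode-far u) d≡4)
      (δ-min (step (CycleOn.⇒Adj cycleP u (next u) (CycAdj-next u))
        (step (f-Adj (next u))
        (step (subst (λ a → Adj G (vA a) (vP (antipode u))) (trans (f-antipode u) (sym eq))
                (Adj-sym (f-Adj (antipode u))))
        here)))))
    (from-no (4 ≤? 3))

  f-surjective : ∀ a → ∃ λ u → f u ≡ a
  f-surjective = proj₁ (classification f f-antipode f-noJump)

  -- Some peripheral `u` is attached to `a` alone, so its link to `vC i` passes through `a`.
  C-A-Adj : ∀ i a → Adj G (vC i) (vA a)
  C-A-Adj i a =
    let u , fu≡a = f-surjective a
        b , p , q = link u i
    in subst (λ x → Adj G (vC i) (vA x)) (trans (sym (f-unique p)) fu≡a) q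

  C-P-nonadjacent : ∀ i u → adj G (vC i) (vP u) ≡ false
  C-P-nonadjacent i u = ¬-not λ a → contradiction
    (subst₂ (λ e e′ → e ≤ suc e′) (trans (ecc-P u) d≡4) (trans (ecc-C i) r≡2)
      (ecc-Adj (Adj-sym a)))
    (from-no (4 ≤? 3))

  cycle-adj : ∀ {S k} (cycle : CycleOn G S k) i j →
    adj G (CycleOn.vertex cycle i) (CycleOn.vertex cycle j) ≡ cyc i j
  cycle-adj cycle i j = ≡true-ext
    (λ a → dec-true (cycAdj? i j) (CycleOn.Adj⇒ cycle i j a))
    (λ a → CycleOn.⇒Adj cycle i j (does⇒ (cycAdj? i j) a))

  A-P-adj : ∀ a u → adj G (vA a) (vP u) ≡ does (f u ≟ᶠ a)
  A-P-adj a u = ≡true-ext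
    (λ p → dec-true (f u ≟ᶠ a) (f-unique (Adj-sym p)))
    (λ e → subst (λ x → Adj G (vA x) (vP u)) (does⇒ (f u ≟ᶠ a) e) (Adj-sym (f-Adj u)))

  label-adj : ∀ x y → adj G (label x) (label y) ≡ adjV f x y
  label-adj (C i) (C j) = cycle-adj cycleC i j
  label-adj (C i) (A a) = C-A-Adj i a
  label-adj (C i) (P u) = C-P-nonadjacent i u
  label-adj (A a) (C i) = Adj-sym (C-A-Adj i a)
  label-adj (A a) (A b) = cycle-adj cycleA a b
  label-adj (A a) (P u) = A-P-adj a u
  label-adj (P u) (C i) = trans (adj-sym G _ _) (C-P-nonadjacent i u)
  label-adj (P u) (A a) = trans (adj-sym G _ _) (A-P-adj a u)
  label-adj (P u) (P v) = cycle-adj cycleP u v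

  G≅H : Iso G (H f)
  G≅H = ↔-sym code ↔-∘ unlabel , λ i j → begin
    adjV f (to code (from code (kind i))) (to code (from code (kind j)))
      ≡⟨ cong₂ (adjV f) (strictlyInverseˡ code (kind i)) (strictlyInverseˡ code (kind j)) ⟩
    adjV f (kind i) (kind j)
      ≡⟨ label-adj (kind i) (kind j) ⟨
    adj G (label (kind i)) (label (kind j))
      ≡⟨ cong₂ (adj G) (label-kind i) (label-kind j) ⟩
    adj G i j ∎
    where
    open ≡-Reasoning

    kind : Fin 15 → V
    kind x = proj₁ (label-surjective x)

    label-kind : ∀ x → label (kind x) ≡ x
    label-kind x = proj₂ (label-surjective x)

    unlabel : Fin 15 ↔ V
    unlabel = mk↔ₛ′ kind label (λ y → label-injective (label-kind (label y))) label-kind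

  G≅attachment : ∃ λ g → Iso G (H (attachment g))
  G≅attachment =
    let g , φ≅ = proj₂ (classification f f-antipode f-noJump)
    in g , Iso-trans G (H f) (H (attachment g)) G≅H φ≅

-- Assembling the bound, the classification and the size.

15≤order : ∀ (n : ℕ) (G : Graph n) → Connected G → MetricCycles G → 15 ≤ n
15≤order n G conn (center , annulus , periphery) =
  Structure.15≤n G conn (proj₂ (toCycleOn center)) (proj₂ (toCycleOn annulus))
                        (proj₂ (toCycleOn periphery))

order15 : (G : Graph 15) → Connected G → MetricCycles G → ∃ λ g → Iso G (H (attachment g))
order15 G conn (center , annulus , periphery)
  with toCycleOn center | toCycleOn annulus | toCycleOn periphery
... | _ , cycleC | _ , cycleA | _ , cycleP
  with Structure.shape G conn cycleC cycleA cycleP ≤-refl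
-- The forced excesses 0, 1 and 5 turn the cycles into ones of order 3, 4 and 8.
... | record { kC≡0 = refl ; kA≡1 = refl ; kP≡5 = refl } =
  Order15.G≅attachment G conn cycleC cycleA cycleP

realised : ∀ g → Connected (H (attachment g)) × MetricCycles (H (attachment g))
realised g = Realisation.connected cert , Realisation.metricCycles cert
  where cert = attachment-certificate g

which : ∀ {G : Graph 15} → (∃ λ g → Iso G (H (attachment g))) → Iso G G₁ ⊎ Iso G G₂ ⊎ Iso G G₃
which (zero             , φ≅) = inj₁ φ≅
which (suc zero         , φ≅) = inj₂ (inj₁ φ≅)
which (suc (suc zero)   , φ≅) = inj₂ (inj₂ φ≅)

theorem10 : ((n : ℕ) (G : Graph n) → Connected G → MetricCycles G → 15 ≤ n)
    × Σ (Graph 15) (λ G₁ → Σ (Graph 15) (λ G₂ → Σ (Graph 15) (λ G₃ →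
    (Connected G₁ × MetricCycles G₁)
    × (Connected G₂ × MetricCycles G₂)
    × (Connected G₃ × MetricCycles G₃)
    × ¬ Iso G₁ G₂ × ¬ Iso G₁ G₃ × ¬ Iso G₂ G₃
    × ((G : Graph 15) → Connected G → MetricCycles G →
    Iso G G₁ ⊎ Iso G G₂ ⊎ Iso G G₃))))
    × ((G : Graph 15) → Connected G → MetricCycles G → size G ≡ 35)
theorem10 =
  15≤order ,
  (G₁ , G₂ , G₃ , realised (# 0) , realised (# 1) , realised (# 2) ,
   G₁≇G₂ , G₁≇G₃ , G₂≇G₃ , λ G conn cycles → which {G} (order15 G conn cycles)) ,
  λ G conn cycles →
    let g , φ≅ = order15 G conn cycles
    in trans (size-Iso G (H (attachment g)) φ≅) (size-attachment g)
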